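{- For every integer $n\ge 0$, the path $P_{n+2}$ on $n+2$ vertices belongs to ${\bf Forb}(\Gamma_{\le n})$; that is, $\gamma(P_{n+2})=n+1$ and $\gamma(P_{n+2}\setminus v)<\gamma(P_{n+2})$ for every vertex $v$.
   Context: For a finite graph $G$ and indeterminates $X_G=\{x_u : u\in V(G)\}$, the generalized Laplacian matrix $L(G,X_G)$ is the $V(G)\times V(G)$ matrix over $\mathbb{Z}[X_G]$ with $(u,u)$-entry $x_u$ and $(u,v)$-entry $-m_{uv}$ for $u\ne v$, $m_{uv}$ being the number of edges between $u$ and $v$. The $i$-th critical ideal $I_i(G,X_G)$ is the ideal of $\mathbb{Z}[X_G]$ generated by all $i\times i$ minors of $L(G,X_G)$ (with $I_i=\langle1\rangle$ for $i<1$, $I_i=\langle 0\rangle$ for $i>|V(G)|$). The algebraic co-rank $\gamma(G)$ is the number of critical ideals of $G$ equal to $\langle 1\rangle$. $\Gamma_{\le k}$ is the set of simple connected graphs with $\gamma\le k$; ${\bf Forb}(\Gamma_{\le k})$ is the set of minimal (under induced subgraphs) simple connected graphs $G$ with $\gamma(G)\ge k+1$, equivalently the simple connected graphs $G$ with $\gamma(G)=k+1$ and $\gamma(G\setminus v)<\gamma(G)$ for all vertices $v$. -}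

module Defs where

open import Algebra.Bundles using (CommutativeRing)
open import Data.Bool.Base using (if_then_else_)
open import Data.Fin.Base as Fin using (Fin; zero; suc; toℕ; punchIn)
import Data.Fin.Properties as Fin
open import Data.Fin.Subset using (Subset; _∈_; ∣_∣)
open import Data.Integer.Base as ℤ using (ℤ; +_)
open import Data.Nat.Base as ℕ using (ℕ; zero; suc; ∣_-_∣)
import Data.Nat.Properties as ℕ
open import Data.Product using (_×_; _,_; ∃₂; ∃-syntax; Σ-syntax)
open import Function.Bundles using (_⇔_)
open import Function.Definitions using (Injective)
open import Level using (0ℓ; _⊔_)
open import Relation.Binary.Core using (_Preserves_⟶_)
open import Relation.Binary.Construct.Closure.ReflexiveTransitive using (Star)
open import Relation.Binary.PropositionalEquality.Core using (_≡_; _≢_; cong)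
open import Relation.Nullary.Decidable.Core using (does)
open import Relation.Nullary.Negation.Core using (¬_)
open import Relation.Unary using (Pred; _≐_)

------------------------------------------------------------------------
-- Determinants, minors and ideals in a commutative ring

module Matrices {c ℓ} (R : CommutativeRing c ℓ) where
  open CommutativeRing R hiding (zero)
  open import Algebra.Definitions.RawMonoid +-rawMonoid using (sum)
  open import Algebra.Properties.Semiring.Exp semiring using (_^_)

  Matrix : ℕ → ℕ → Set c
  Matrix m n = Fin m → Fin n → Carrier

  -- Laplace expansion along the first row.
  det : ∀ {n} → Matrix n n → Carrier
  det {zero}  A = 1#
  det {suc n} A =
    sum λ j → (- 1#) ^ toℕ j * (A zero j * det λ r s → A (suc r) (punchIn j s))

  -- The row set and the column set of a minor are listed in increasing order.
  -- For i = 0 the only minor is the empty determinant 1#, and for i > m or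
  -- i > n there are none.
  IsMinor : ∀ {m n} (i : ℕ) → Matrix m n → Pred Carrier ℓ
  IsMinor {m} {n} i A p =
    Σ[ rows ∈ (Fin i → Fin m) ] Σ[ cols ∈ (Fin i → Fin n) ]
      (rows Preserves Fin._<_ ⟶ Fin._<_) ×
      (cols Preserves Fin._<_ ⟶ Fin._<_) ×
      p ≈ det (λ r s → A (rows r) (cols s))

  data ⟨_⟩ {s} (S : Pred Carrier s) : Pred Carrier (c ⊔ ℓ ⊔ s) where
    gen  : ∀ {p} → S p → ⟨ S ⟩ p
    null : ⟨ S ⟩ 0#
    add  : ∀ {p q} → ⟨ S ⟩ p → ⟨ S ⟩ q → ⟨ S ⟩ (p + q)
    mul  : ∀ r {p} → ⟨ S ⟩ p → ⟨ S ⟩ (r * p)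
    resp : ∀ {p q} → p ≈ q → ⟨ S ⟩ p → ⟨ S ⟩ q

------------------------------------------------------------------------
-- The polynomial ring ℤ[X]: the free commutative ring on a set X of
-- indeterminates, as ring expressions with integer coefficients modulo the
-- congruence generated by the commutative ring laws and the arithmetic of ℤ

module Polynomials (X : Set) where

  infixl 6 _:+_
  infixl 7 _:*_
  infix  8 :-_
  infix  4 _≈_

  data Poly : Set where
    var       : X → Poly
    con       : ℤ → Poly
    _:+_ _:*_ : Poly → Poly → Poly
    :-_       : Poly → Poly

  data _≈_ : Poly → Poly → Set where
    ≈-refl  : ∀ {p} → p ≈ p
    ≈-sym   : ∀ {p q} → p ≈ q → q ≈ p
    ≈-trans : ∀ {p q r} → p ≈ q → q ≈ r → p ≈ r

    +-cong : ∀ {p p′ q q′} → p ≈ p′ → q ≈ q′ → p :+ q ≈ p′ :+ q′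
    *-cong : ∀ {p p′ q q′} → p ≈ p′ → q ≈ q′ → p :* q ≈ p′ :* q′
    -‿cong : ∀ {p p′} → p ≈ p′ → :- p ≈ :- p′

    con-+ : ∀ a b → con (a ℤ.+ b) ≈ con a :+ con b
    con-* : ∀ a b → con (a ℤ.* b) ≈ con a :* con b

    +-assoc     : ∀ p q r → (p :+ q) :+ r ≈ p :+ (q :+ r)
    +-comm      : ∀ p q → p :+ q ≈ q :+ p
    +-identityˡ : ∀ p → con (+ 0) :+ p ≈ p
    -‿inverseˡ  : ∀ p → (:- p) :+ p ≈ con (+ 0)
    *-assoc     : ∀ p q r → (p :* q) :* r ≈ p :* (q :* r)
    *-comm      : ∀ p q → p :* q ≈ q :* p
    *-identityˡ : ∀ p → con (+ 1) :* p ≈ p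
    distribˡ    : ∀ p q r → p :* (q :+ r) ≈ p :* q :+ p :* r

  ℤ[X] : CommutativeRing 0ℓ 0ℓ
  ℤ[X] = record
    { Carrier = Poly
    ; _≈_ = _≈_
    ; _+_ = _:+_
    ; _*_ = _:*_
    ; -_  = :-_
    ; 0#  = con (+ 0)
    ; 1#  = con (+ 1)
    ; isCommutativeRing = record
      { isRing = record
        { +-isAbelianGroup = record
          { isGroup = record
            { isMonoid = record
              { isSemigroup = record
                { isMagma = record
                  { isEquivalence = record
                    { refl = ≈-refl ; sym = ≈-sym ; trans = ≈-trans }
                  ; ∙-cong = +-cong
                  }
                ; assoc = +-assoc
                }
              ; identity = +-identityˡ ,
                  λ p → ≈-trans (+-comm p _) (+-identityˡ p)
              }
            ; inverse = -‿inverseˡ ,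
                λ p → ≈-trans (+-comm p _) (-‿inverseˡ p)
            ; ⁻¹-cong = -‿cong
            }
          ; comm = +-comm
          }
        ; *-cong = *-cong
        ; *-assoc = *-assoc
        ; *-identity = *-identityˡ ,
            λ p → ≈-trans (*-comm p _) (*-identityˡ p)
        ; distrib = distribˡ ,
            λ p q r → ≈-trans (*-comm (q :+ r) p)
              (≈-trans (distribˡ p q r) (+-cong (*-comm p q) (*-comm p r)))
        }
      ; *-comm = *-comm
      }
    }

------------------------------------------------------------------------
-- Graphs

-- A finite multigraph on the vertex set Fin n.
record Graph (n : ℕ) : Set where
  field
    mult     : Fin n → Fin n → ℕ
    mult-sym : ∀ u v → mult u v ≡ mult v u

open Graph public

private
  variable
    m n : ℕ

record Simple (G : Graph n) : Set where
  field
    loopless    : ∀ v → mult G v v ≡ 0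
    no-parallel : ∀ u v → mult G u v ℕ.≤ 1

Adjacent : Graph n → Fin n → Fin n → Set
Adjacent G u v = mult G u v ≢ 0

Connected : Graph n → Set
Connected G = ∀ u v → Star (Adjacent G) u v

infixl 6 _∖_

_∖_ : Graph (suc n) → Fin (suc n) → Graph n
G ∖ v = record
  { mult     = λ a b → mult G (punchIn v a) (punchIn v b)
  ; mult-sym = λ a b → mult-sym G (punchIn v a) (punchIn v b)
  }

-- H is isomorphic to an induced subgraph of G.
InducedSubgraph : Graph m → Graph n → Set
InducedSubgraph {m} {n} H G =
  Σ[ f ∈ (Fin m → Fin n) ]
    Injective _≡_ _≡_ f × (∀ u v → mult H u v ≡ mult G (f u) (f v))

path : ∀ n → Graph n
path n = record
  { mult     = λ u v → edge ∣ toℕ u - toℕ v ∣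
  ; mult-sym = λ u v → cong edge (ℕ.∣-∣-comm (toℕ u) (toℕ v))
  }
  where
  edge : ℕ → ℕ
  edge d = if does (d ℕ.≟ 1) then 1 else 0

------------------------------------------------------------------------
-- Critical ideals and the algebraic co-rank

module _ {n : ℕ} (G : Graph n) where
  open Polynomials (Fin n)
  open Matrices ℤ[X]

  laplacian : Matrix n n
  laplacian u v = if does (u Fin.≟ v) then var u else con (ℤ.- (+ mult G u v))

  CriticalIdeal : ℕ → Pred Poly 0ℓ
  CriticalIdeal i = ⟨ IsMinor i laplacian ⟩

  UnitIdeal : Pred Poly 0ℓ
  UnitIdeal = ⟨ _≈ con (+ 1) ⟩

  -- γ(G) = k, as a relation since triviality of an ideal is not decided here.
  -- Only the indices 1, …, n are counted: the ideals with index i < 1 are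
  -- ⟨ 1 ⟩ and those with index i > n are ⟨ 0 ⟩ by convention.
  CoRank : ℕ → Set
  CoRank k =
    Σ[ T ∈ Subset n ]
      (∀ i → i ∈ T ⇔ (CriticalIdeal (suc (toℕ i)) ≐ UnitIdeal)) × ∣ T ∣ ≡ k

infix 4 _γ<_

_γ<_ : Graph m → Graph n → Set
H γ< G = ∃₂ λ a b → CoRank H a × CoRank G b × a ℕ.< b

-- Simple connected graphs outside Γ≤ k.
Forbidden : ℕ → Graph n → Set
Forbidden k G =
  Simple G × Connected G × (∃[ a ] CoRank G a × suc k ℕ.≤ a)

-- Forb(Γ≤ k).  An induced subgraph is proper when it has fewer vertices.
Forb : ℕ → Graph n → Set
Forb {n} k G =
  Forbidden k G ×
  (∀ {m} (H : Graph m) → InducedSubgraph H G → m ℕ.< n → ¬ Forbidden k H)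

{-# OPTIONS --safe #-}
-- Taking rows u and columns u + 1 for vertices u with an edge to u + 1 gives
-- a lower triangular minor with diagonal −1, so Iₖ = ⟨ 1 ⟩ when a path or a
-- vertex-deleted path has k such edges.  Conversely, substituting the degrees
-- for the indeterminates turns L(G, X) into the ordinary Laplacian over ℤ, whose
-- kernel contains the vectors constant on connected components.  Hence the
-- determinant vanishes there for every nonempty graph, and for a disconnected
-- graph on m + 1 vertices so do all m × m minors: the corresponding ideals are
-- proper.  In particular γ(H) < |V(H)| for every nonempty H, which bounds the
-- co-rank of any graph with fewer vertices than the path.
module Submission where

open import Defs
open import Algebra.Bundles using (CommutativeRing)
open import Data.Bool.Base using (Bool; true; false; if_then_else_)
import Data.Bool.Properties as Bool
open import Data.Nat.Base using (ℕ; zero; suc; _+_; _≤_; _<_; z≤n; s≤s; ∣_-_∣)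
import Data.Nat.Properties as ℕ
open import Data.Fin.Base as Fin
  using (Fin; zero; suc; toℕ; fromℕ; inject₁; inject≤; punchIn; punchOut)
import Data.Fin.Properties as Fin
open import Data.Fin.Relation.Unary.Top using (view; ‵fromℕ; ‵inject₁)
open import Data.Fin.Subset using (Subset; inside; ⊥; _∈_; ∣_∣)
import Data.Fin.Subset.Properties as Subset
open import Data.Integer.Base as ℤ using (ℤ; +_)
import Data.Integer.Properties as ℤ
open import Data.Product using (_×_; _,_; ∃; proj₁; proj₂)
open import Data.Sum.Base using (_⊎_; inj₁; inj₂)
open import Data.Vec.Base using (_∷_; here; there)
open import Function.Base using (_∘_; id)
open import Function.Bundles using (_⇔_; mk⇔; Equivalence)
open import Relation.Binary.Construct.Closure.ReflexiveTransitive
  using (ε; _◅_; _◅◅_; gmap)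
open import Relation.Binary.Core using (_Preserves_⟶_)
open import Relation.Binary.Definitions using (tri<; tri≈; tri>)
open import Relation.Binary.PropositionalEquality as ≡ using (_≡_; _≢_)
open import Relation.Nullary.Decidable using (yes; no; does; dec-true; dec-false)
open import Relation.Nullary.Negation using (¬_; contradiction)
open import Relation.Unary using (_≐_)

-- Omitting an index from a list of columns

private
  -- Omitting column `j` keeps columns `p` and `p + 1` next to each other unless `j` is one of them;
  -- `q` is their new position.
  punchIn-adjacent : ∀ {n} (j : Fin (2 + n)) (p : Fin (1 + n)) →
    j ≡ inject₁ p ⊎ j ≡ suc p ⊎
    ∃ λ (q : Fin n) → punchIn j (inject₁ q) ≡ inject₁ p × punchIn j (suc q) ≡ suc p
  punchIn-adjacent zero zero = inj₁ ≡.refl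
  punchIn-adjacent {suc n} zero (suc p) = inj₂ (inj₂ (p , ≡.refl , ≡.refl))
  punchIn-adjacent (suc zero) zero = inj₂ (inj₁ ≡.refl)
  punchIn-adjacent {suc n} (suc (suc j)) zero = inj₂ (inj₂ (zero , ≡.refl , ≡.refl))
  punchIn-adjacent {suc n} (suc j) (suc p) with punchIn-adjacent j p
  ... | inj₁ eq = inj₁ (≡.cong suc eq)
  ... | inj₂ (inj₁ eq) = inj₂ (inj₁ (≡.cong suc eq))
  ... | inj₂ (inj₂ (q , eq , eq′)) =
    inj₂ (inj₂ (suc q , ≡.cong suc eq , ≡.cong suc eq′))

  -- If columns `p` and `p + 1` of a matrix agree, this makes the two minors omitting one or the
  -- other coincide.
  punchIn-inject₁-suc : ∀ {n} (p : Fin (1 + n)) (s : Fin (1 + n)) →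
    punchIn (inject₁ p) s ≡ punchIn (suc p) s ⊎
    punchIn (inject₁ p) s ≡ suc p × punchIn (suc p) s ≡ inject₁ p
  punchIn-inject₁-suc zero zero = inj₂ (≡.refl , ≡.refl)
  punchIn-inject₁-suc zero (suc s) = inj₁ ≡.refl
  punchIn-inject₁-suc (suc p) zero = inj₁ ≡.refl
  punchIn-inject₁-suc {suc n} (suc p) (suc s) with punchIn-inject₁-suc p s
  ... | inj₁ eq = inj₁ (≡.cong suc eq)
  ... | inj₂ (eq , eq′) = inj₂ (≡.cong suc eq , ≡.cong suc eq′)

  inject₁-mono-< : ∀ {n} {x y : Fin n} → x Fin.< y → inject₁ x Fin.< inject₁ y
  inject₁-mono-< {x = x} {y} =
    ≡.subst₂ _<_ (≡.sym (Fin.toℕ-inject₁ x)) (≡.sym (Fin.toℕ-inject₁ y))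

  inject₁≢suc : ∀ {n} (p : Fin n) → inject₁ p ≢ suc p
  inject₁≢suc p eq = ℕ.m≢1+m+n _ (≡.trans (≡.sym (Fin.toℕ-inject₁ p))
    (≡.trans (≡.cong toℕ eq) (≡.cong suc (≡.sym (ℕ.+-identityʳ _)))))

-- Determinants

module Determinants {c ℓ} (R : CommutativeRing c ℓ) where
  open CommutativeRing R hiding (zero) renaming (_+_ to _⊕_)
  open Matrices R
  open import Algebra.Properties.Semiring.Sum semiring
  open import Algebra.Properties.Semiring.Exp semiring using (_^_)
  open import Algebra.Properties.Ring ring using (-1*x≈-x; -‿involutive)
  open import Algebra.Properties.CommutativeSemigroup *-commutativeSemigroup
    using (x∙yz≈y∙xz; interchange)
  open import Relation.Binary.Reasoning.Setoid setoid

  sum-zero : ∀ {n} {t : Fin n → Carrier} → (∀ j → t j ≈ 0#) → sum t ≈ 0#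
  sum-zero {n} t≈0 = trans (sum-cong-≋ t≈0) (sum-replicate-zero n)

  sum-single : ∀ {n} (t : Fin n → Carrier) (j : Fin n) →
    (∀ k → k ≢ j → t k ≈ 0#) → sum t ≈ t j
  sum-single {suc n} t j t≈0 = begin
    sum t                          ≈⟨ sum-remove t ⟩
    t j ⊕ sum (t ∘ punchIn j)      ≈⟨ +-congˡ (sum-zero λ k → t≈0 _ (Fin.punchInᵢ≢i j k)) ⟩
    t j ⊕ 0#                       ≈⟨ +-identityʳ _ ⟩
    t j                            ∎

  sum-adjacent : ∀ {n} (t : Fin (2 + n) → Carrier) (p : Fin (1 + n)) →
    (∀ j → j ≢ inject₁ p → j ≢ suc p → t j ≈ 0#) →
    t (inject₁ p) ⊕ t (suc p) ≈ 0# → sum t ≈ 0#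
  sum-adjacent t zero t≈0 cancel = begin
    t zero ⊕ (t (suc zero) ⊕ sum (λ j → t (suc (suc j)))) ≈⟨ +-congˡ (+-congˡ (sum-zero {t = λ j → t (suc (suc j))}
      λ j → t≈0 (suc (suc j)) (λ ()) (λ ()))) ⟩
    t zero ⊕ (t (suc zero) ⊕ 0#)                  ≈⟨ +-congˡ (+-identityʳ _) ⟩
    t zero ⊕ t (suc zero)                         ≈⟨ cancel ⟩
    0#                                            ∎
  sum-adjacent {suc n} t (suc p) t≈0 cancel = begin
    t zero ⊕ sum (t ∘ suc) ≈⟨ +-cong (t≈0 zero (λ ()) (λ ()))
      (sum-adjacent (t ∘ suc) p
        (λ j j≢p j≢p′ → t≈0 (suc j) (j≢p ∘ Fin.suc-injective) (j≢p′ ∘ Fin.suc-injective))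
        cancel) ⟩
    0# ⊕ 0#                ≈⟨ +-identityˡ 0# ⟩
    0#                     ∎

  det-cong : ∀ {n} {A B : Matrix n n} → (∀ r s → A r s ≈ B r s) → det A ≈ det B
  det-cong {zero}  A≈B = refl
  det-cong {suc n} A≈B = sum-cong-≋ λ j →
    *-congˡ {x = (- 1#) ^ toℕ j} (*-cong (A≈B zero j) (det-cong λ r s → A≈B (suc r) (punchIn j s)))

  det-lowerTriangular : ∀ {n} (A : Matrix n n) →
    (∀ i j → i Fin.< j → A i j ≈ 0#) → (∀ i → A i i ≈ - 1#) →
    det A ≈ (- 1#) ^ n
  det-lowerTriangular {zero}  A above diag = refl
  det-lowerTriangular {suc n} A above diag = begin
    det A                               ≈⟨ sum-single term zero vanish ⟩
    1# * (A zero zero * det A′)         ≈⟨ *-identityˡ _ ⟩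
    A zero zero * det A′                ≈⟨ *-cong (diag zero) (det-lowerTriangular A′
                                             (λ i j i<j → above (suc i) (suc j) (s≤s i<j)) (diag ∘ suc)) ⟩
    (- 1#) * (- 1#) ^ n                 ∎
    where
    A′ : Matrix n n
    A′ r s = A (suc r) (suc s)
    term : Fin (suc n) → Carrier
    term j = (- 1#) ^ toℕ j * (A zero j * det λ r s → A (suc r) (punchIn j s))
    vanish : ∀ j → j ≢ zero → term j ≈ 0#
    vanish zero    j≢0 = contradiction ≡.refl j≢0
    vanish (suc j) j≢0 = begin
      term (suc j)  ≈⟨ *-congˡ (*-congʳ (above zero (suc j) (s≤s z≤n))) ⟩
      _ * (0# * _)  ≈⟨ *-congˡ (zeroˡ _) ⟩
      _ * 0#        ≈⟨ zeroʳ _ ⟩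
      0#            ∎

  -- Expand along the first row: the term omitting column `p` is linear through its entry, every
  -- other term through its minor, by induction. The arbitrary number `m` of summands covers a zero
  -- column (`m = 0`), additivity (`m = 2`) and a combination of all columns.
  det-linear : ∀ {m n} (A : Matrix n n) (B : Fin m → Matrix n n)
    (v : Fin m → Carrier) (p : Fin n) →
    (∀ r → A r p ≈ sum λ t → v t * B t r p) →
    (∀ t r s → s ≢ p → A r s ≈ B t r s) →
    det A ≈ sum λ t → v t * det (B t)
  det-linear {m} {suc n} A B v p col rest = begin
    sum (λ j → sgn j * (A zero j * D A j))   ≈⟨ sum-cong-≋ expand ⟩
    sum (λ j → sum λ t → v t * term t j)     ≈⟨ ∑-comm (λ j t → v t * term t j) ⟩
    sum (λ t → sum λ j → v t * term t j)     ≈⟨ sum-cong-≋ (λ t → *-distribˡ-sum (v t) (term t)) ⟨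
    sum (λ t → v t * det (B t))              ∎
    where
    sgn : Fin (suc n) → Carrier
    sgn j = (- 1#) ^ toℕ j
    D : Matrix (suc n) (suc n) → Fin (suc n) → Carrier
    D M j = det λ r s → M (suc r) (punchIn j s)
    term : Fin m → Fin (suc n) → Carrier
    term t j = sgn j * (B t zero j * D (B t) j)

    expand : ∀ j → sgn j * (A zero j * D A j) ≈ sum λ t → v t * term t j
    expand j with j Fin.≟ p
    ... | yes ≡.refl = begin
      sgn p * (A zero p * D A p)
        ≈⟨ *-congˡ (*-congʳ (col zero)) ⟩
      sgn p * (sum (λ t → v t * B t zero p) * D A p)
        ≈⟨ *-congˡ (*-distribʳ-sum (D A p) (λ t → v t * B t zero p)) ⟩
      sgn p * sum (λ t → (v t * B t zero p) * D A p)
        ≈⟨ *-distribˡ-sum (sgn p) (λ t → (v t * B t zero p) * D A p) ⟩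
      sum (λ t → sgn p * ((v t * B t zero p) * D A p))
        ≈⟨ sum-cong-≋ (λ t → begin
            sgn p * ((v t * B t zero p) * D A p)   ≈⟨ *-congˡ (*-assoc _ _ _) ⟩
            sgn p * (v t * (B t zero p * D A p))   ≈⟨ x∙yz≈y∙xz _ _ _ ⟩
            v t * (sgn p * (B t zero p * D A p))   ≈⟨ *-congˡ (*-congˡ (*-congˡ
              (det-cong λ r s → rest t (suc r) (punchIn p s) (Fin.punchInᵢ≢i p s)))) ⟩
            v t * term t p                         ∎) ⟩
      sum (λ t → v t * term t p) ∎
    ... | no j≢p = begin
      sgn j * (A zero j * D A j)
        ≈⟨ *-congˡ (*-congˡ minor) ⟩
      sgn j * (A zero j * sum (λ t → v t * D (B t) j))
        ≈⟨ *-congˡ (*-distribˡ-sum (A zero j) (λ t → v t * D (B t) j)) ⟩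
      sgn j * sum (λ t → A zero j * (v t * D (B t) j))
        ≈⟨ *-distribˡ-sum (sgn j) (λ t → A zero j * (v t * D (B t) j)) ⟩
      sum (λ t → sgn j * (A zero j * (v t * D (B t) j)))
        ≈⟨ sum-cong-≋ (λ t → begin
            sgn j * (A zero j * (v t * D (B t) j))   ≈⟨ *-congˡ (x∙yz≈y∙xz _ _ _) ⟩
            sgn j * (v t * (A zero j * D (B t) j))   ≈⟨ x∙yz≈y∙xz _ _ _ ⟩
            v t * (sgn j * (A zero j * D (B t) j))   ≈⟨ *-congˡ (*-congˡ (*-congʳ (rest t zero j j≢p))) ⟩
            v t * term t j                           ∎) ⟩
      sum (λ t → v t * term t j) ∎
      where
      q = punchOut j≢p
      at-q : punchIn j q ≡ p
      at-q = Fin.punchIn-punchOut j≢p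
      minor : D A j ≈ sum λ t → v t * D (B t) j
      minor = det-linear (λ r s → A (suc r) (punchIn j s)) (λ t r s → B t (suc r) (punchIn j s)) v q
        (λ r → ≡.subst (λ x → A (suc r) x ≈ sum λ t → v t * B t (suc r) x) (≡.sym at-q) (col (suc r)))
        (λ t r s s≢q → rest t (suc r) (punchIn j s)
          (λ eq → s≢q (Fin.punchIn-injective j s q (≡.trans eq (≡.sym at-q)))))

  det-additive : ∀ {n} (A B C : Matrix n n) (p : Fin n) →
    (∀ r → A r p ≈ B r p ⊕ C r p) →
    (∀ r s → s ≢ p → A r s ≈ B r s) → (∀ r s → s ≢ p → A r s ≈ C r s) →
    det A ≈ det B ⊕ det C
  det-additive A B C p col restB restC =
    trans (det-linear A pair (λ _ → 1#) p
      (λ r → trans (col r) (sym (simplify _ _))) rest) (simplify _ _)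
    where
    pair : Fin 2 → Matrix _ _
    pair zero       = B
    pair (suc zero) = C
    rest : ∀ t r s → s ≢ p → A r s ≈ pair t r s
    rest zero       = restB
    rest (suc zero) = restC
    simplify : ∀ x y → 1# * x ⊕ (1# * y ⊕ 0#) ≈ x ⊕ y
    simplify x y = +-cong (*-identityˡ x) (trans (+-identityʳ _) (*-identityˡ y))

  det-zeroColumn : ∀ {n} (A : Matrix n n) (p : Fin n) → (∀ r → A r p ≈ 0#) → det A ≈ 0#
  det-zeroColumn A p col = det-linear {0} A (λ ()) (λ ()) p col (λ ())

  -- In the first-row expansion a term omitting any other column has a minor with two equal adjacent
  -- columns, zero by induction. The two remaining terms have equal entries, equal minors and
  -- opposite signs, because the columns are neighbours.
  det-adjacentColumns : ∀ {n} (A : Matrix (2 + n) (2 + n)) (p : Fin (1 + n)) →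
    (∀ r → A r (inject₁ p) ≈ A r (suc p)) → det A ≈ 0#
  det-adjacentColumns {n} A p eqCols = sum-adjacent term p vanish cancel
    where
    D : Fin (2 + n) → Carrier
    D j = det λ r s → A (suc r) (punchIn j s)
    term : Fin (2 + n) → Carrier
    term j = (- 1#) ^ toℕ j * (A zero j * D j)

    -- With the size `m` generalised, the existence of `q` shows that the minor has at least two
    -- columns, as the recursive call requires.
    minor : ∀ {m} j (q : Fin m) (M : Fin (1 + m) → Fin (2 + m) → Carrier) {p : Fin (1 + m)} →
      punchIn j (inject₁ q) ≡ inject₁ p → punchIn j (suc q) ≡ suc p →
      (∀ r → M r (inject₁ p) ≈ M r (suc p)) → det (λ r s → M r (punchIn j s)) ≈ 0#
    minor {suc m} j q M eq eq′ h = det-adjacentColumns (λ r s → M r (punchIn j s)) q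
      λ r → ≡.subst₂ (λ x y → M r x ≈ M r y) (≡.sym eq) (≡.sym eq′) (h r)

    vanish : ∀ j → j ≢ inject₁ p → j ≢ suc p → term j ≈ 0#
    vanish j j≢p j≢p′ with punchIn-adjacent j p
    ... | inj₁ eq = contradiction eq j≢p
    ... | inj₂ (inj₁ eq) = contradiction eq j≢p′
    ... | inj₂ (inj₂ (q , eq , eq′)) = begin
      term j        ≈⟨ *-congˡ (*-congˡ (minor j q (A ∘ suc) eq eq′ (eqCols ∘ suc))) ⟩
      _ * (_ * 0#)  ≈⟨ *-congˡ (zeroʳ _) ⟩
      _ * 0#        ≈⟨ zeroʳ _ ⟩
      0#            ∎

    sameMinor : ∀ r s → A (suc r) (punchIn (inject₁ p) s) ≈ A (suc r) (punchIn (suc p) s)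
    sameMinor r s with punchIn-inject₁-suc p s
    ... | inj₁ eq = reflexive (≡.cong (A (suc r)) eq)
    ... | inj₂ (eq , eq′) = ≡.subst₂ (λ x y → A (suc r) x ≈ A (suc r) y)
      (≡.sym eq) (≡.sym eq′) (sym (eqCols (suc r)))

    cancel : term (inject₁ p) ⊕ term (suc p) ≈ 0#
    cancel = begin
      term (inject₁ p) ⊕ term (suc p)
        ≈⟨ +-congʳ (*-cong (reflexive (≡.cong ((- 1#) ^_) (Fin.toℕ-inject₁ p)))
             (*-cong (eqCols zero) (det-cong sameMinor))) ⟩
      σ * x ⊕ ((- 1#) * σ) * x  ≈⟨ +-congˡ (*-assoc _ _ _) ⟩
      σ * x ⊕ (- 1#) * (σ * x)  ≈⟨ +-congˡ (-1*x≈-x _) ⟩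
      σ * x ⊕ - (σ * x)         ≈⟨ -‿inverseʳ _ ⟩
      0#                        ∎
      where
      σ = (- 1#) ^ toℕ p
      x = A zero (suc p) * D (suc p)

  -- Polarisation: as a function of the columns `p` and `p + 1` the determinant is biadditive and
  -- vanishes when they agree. Expanding it with `a+b` in both places leaves the two mixed terms.
  det-swapAdjacent : ∀ {n} (A B : Matrix (2 + n) (2 + n)) (p : Fin (1 + n)) →
    (∀ r → B r (inject₁ p) ≈ A r (suc p)) → (∀ r → B r (suc p) ≈ A r (inject₁ p)) →
    (∀ r s → s ≢ inject₁ p → s ≢ suc p → B r s ≈ A r s) →
    det A ⊕ det B ≈ 0#
  det-swapAdjacent {n} A B p left right rest = begin
    det A ⊕ det B                          ≈⟨ +-cong (det-cong A≈) (det-cong B≈) ⟩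
    det (F a b) ⊕ det (F b a)              ≈⟨ +-cong (+-identityˡ _) (+-identityʳ _) ⟨
    (0# ⊕ det (F a b)) ⊕ (det (F b a) ⊕ 0#) ≈⟨ +-cong (+-congʳ (diagonal a)) (+-congˡ (diagonal b)) ⟨
    (det (F a a) ⊕ det (F a b)) ⊕ (det (F b a) ⊕ det (F b b)) ≈⟨ +-cong (additiveʳ a) (additiveʳ b) ⟨
    det (F a a+b) ⊕ det (F b a+b)          ≈⟨ additiveˡ a+b ⟨
    det (F a+b a+b)                        ≈⟨ diagonal a+b ⟩
    0#                                     ∎
    where
    Column = Fin (2 + n) → Carrier
    F : Column → Column → Matrix (2 + n) (2 + n)
    F x y r s = if does (s Fin.≟ inject₁ p) then x r else
      (if does (s Fin.≟ suc p) then y r else A r s)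
    a b a+b : Column
    a r = A r (inject₁ p)
    b r = A r (suc p)
    a+b r = a r ⊕ b r

    F-left : ∀ x y r → F x y r (inject₁ p) ≡ x r
    F-left x y r rewrite dec-true (inject₁ p Fin.≟ inject₁ p) ≡.refl = ≡.refl
    F-right : ∀ x y r → F x y r (suc p) ≡ y r
    F-right x y r
      rewrite dec-false (suc p Fin.≟ inject₁ p) (inject₁≢suc p ∘ ≡.sym)
            | dec-true (p Fin.≟ p) ≡.refl = ≡.refl

    A≈ : ∀ r s → A r s ≈ F a b r s
    A≈ r s with s Fin.≟ inject₁ p
    ... | yes ≡.refl = refl
    ... | no _ with s Fin.≟ suc p
    ...   | yes ≡.refl = refl
    ...   | no _ = refl
    B≈ : ∀ r s → B r s ≈ F b a r s
    B≈ r s with s Fin.≟ inject₁ p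
    ... | yes ≡.refl = left r
    ... | no s≢p with s Fin.≟ suc p
    ...   | yes ≡.refl = right r
    ...   | no s≢p′ = rest r s s≢p s≢p′

    diagonal : ∀ x → det (F x x) ≈ 0#
    diagonal x = det-adjacentColumns (F x x) p
      λ r → reflexive (≡.trans (F-left x x r) (≡.sym (F-right x x r)))

    off-left : ∀ x x′ y r s → s ≢ inject₁ p → F x y r s ≈ F x′ y r s
    off-left x x′ y r s s≢p rewrite dec-false (s Fin.≟ inject₁ p) s≢p = refl
    off-right : ∀ x y y′ r s → s ≢ suc p → F x y r s ≈ F x y′ r s
    off-right x y y′ r s s≢p rewrite dec-false (s Fin.≟ suc p) s≢p = refl

    additiveˡ : ∀ y → det (F a+b y) ≈ det (F a y) ⊕ det (F b y)
    additiveˡ y = det-additive (F a+b y) (F a y) (F b y) (inject₁ p)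
      (λ r → reflexive (≡.trans (F-left a+b y r)
        (≡.sym (≡.cong₂ _⊕_ (F-left a y r) (F-left b y r)))))
      (off-left a+b a y) (off-left a+b b y)
    additiveʳ : ∀ x → det (F x a+b) ≈ det (F x a) ⊕ det (F x b)
    additiveʳ x = det-additive (F x a+b) (F x a) (F x b) (suc p)
      (λ r → reflexive (≡.trans (F-right x a+b r)
        (≡.sym (≡.cong₂ _⊕_ (F-right x a r) (F-right x b r)))))
      (off-right x a+b a) (off-right x a+b b)

  -- Adjacent swaps move the right-hand column q down to p.
  det-equalColumns-< : ∀ {n} (d : ℕ) (A : Matrix n n) (p q : Fin n) → p Fin.< q → toℕ q ≤ d →
    (∀ r → A r p ≈ A r q) → det A ≈ 0#
  det-equalColumns-< {suc (suc n)} (suc d) A p (suc q) p<q (s≤s q≤d) eqCols with p Fin.≟ inject₁ q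
  ... | yes ≡.refl = det-adjacentColumns A q eqCols
  ... | no p≢q = begin
    det A         ≈⟨ +-identityʳ _ ⟨
    det A ⊕ 0#    ≈⟨ +-congˡ B≈0 ⟨
    det A ⊕ det B ≈⟨ det-swapAdjacent A B q (reflexive ∘ B-left) (reflexive ∘ B-right)
                       (λ r s s≢q s≢q′ → reflexive (B-rest r s s≢q s≢q′)) ⟩
    0#            ∎
    where
    swap : Fin (2 + n) → Fin (2 + n)
    swap s = if does (s Fin.≟ inject₁ q) then suc q else
      (if does (s Fin.≟ suc q) then inject₁ q else s)
    B : Matrix (2 + n) (2 + n)
    B r s = A r (swap s)
    B-left : ∀ r → B r (inject₁ q) ≡ A r (suc q)
    B-left r rewrite dec-true (inject₁ q Fin.≟ inject₁ q) ≡.refl = ≡.refl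
    B-right : ∀ r → B r (suc q) ≡ A r (inject₁ q)
    B-right r
      rewrite dec-false (suc q Fin.≟ inject₁ q) (inject₁≢suc q ∘ ≡.sym)
            | dec-true (q Fin.≟ q) ≡.refl = ≡.refl
    B-rest : ∀ r s → s ≢ inject₁ q → s ≢ suc q → B r s ≡ A r s
    B-rest r s s≢q s≢q′
      rewrite dec-false (s Fin.≟ inject₁ q) s≢q | dec-false (s Fin.≟ suc q) s≢q′ = ≡.refl
    p<q′ : p Fin.< inject₁ q
    p<q′ = ℕ.≤∧≢⇒< (≡.subst (toℕ p ≤_) (≡.sym (Fin.toℕ-inject₁ q)) (ℕ.≤-pred p<q))
      (p≢q ∘ Fin.toℕ-injective)
    B≈0 : det B ≈ 0#
    -- `inject₁ q` is not a subterm of `suc q`, hence the recursion on the bound `d`.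
    B≈0 = det-equalColumns-< d B p (inject₁ q) p<q′
      (≡.subst (_≤ d) (≡.sym (Fin.toℕ-inject₁ q)) q≤d)
      λ r → trans (reflexive (B-rest r p p≢q (Fin.<⇒≢ p<q)))
        (trans (eqCols r) (reflexive (≡.sym (B-left r))))

  det-equalColumns : ∀ {n} (A : Matrix n n) {p q : Fin n} → p ≢ q →
    (∀ r → A r p ≈ A r q) → det A ≈ 0#
  det-equalColumns A {p} {q} p≢q eqCols with ℕ.<-cmp (toℕ p) (toℕ q)
  ... | tri< p<q _ _ = det-equalColumns-< (toℕ q) A p q p<q ℕ.≤-refl eqCols
  ... | tri≈ _ p≡q _ = contradiction (Fin.toℕ-injective p≡q) p≢q
  ... | tri> _ _ q<p = det-equalColumns-< (toℕ p) A q p q<p ℕ.≤-refl (sym ∘ eqCols)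

  -- Replacing column j by the combination ∑ vₛ (column s) = 0 scales the
  -- determinant by vⱼ = 1.
  det-kernel : ∀ {n} (A : Matrix n n) (v : Fin n → Carrier) →
    (∀ r → sum (λ s → A r s * v s) ≈ 0#) → ∀ j → v j ≈ 1# → det A ≈ 0#
  det-kernel {n} A v Av≈0 j vj≈1 = begin
    det A                         ≈⟨ *-identityˡ _ ⟨
    1# * det A                    ≈⟨ *-cong vj≈1 (det-cong Bj≈A) ⟨
    v j * det (B j)               ≈⟨ sum-single (λ t → v t * det (B t)) j repeated ⟨
    sum (λ t → v t * det (B t))   ≈⟨ det-linear Z B v j Z-col Z-rest ⟨
    det Z                         ≈⟨ det-zeroColumn Z j (λ r → reflexive (Z-j r)) ⟩
    0#                            ∎
    where
    B : Fin n → Matrix n n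
    B t r s = A r (if does (s Fin.≟ j) then t else s)
    Z : Matrix n n
    Z r s = if does (s Fin.≟ j) then 0# else A r s
    Z-j : ∀ r → Z r j ≡ 0#
    Z-j r rewrite dec-true (j Fin.≟ j) ≡.refl = ≡.refl
    B-j : ∀ t r → B t r j ≡ A r t
    B-j t r rewrite dec-true (j Fin.≟ j) ≡.refl = ≡.refl
    B-off : ∀ t r s → s ≢ j → B t r s ≡ A r s
    B-off t r s s≢j rewrite dec-false (s Fin.≟ j) s≢j = ≡.refl
    Bj≈A : ∀ r s → B j r s ≈ A r s
    Bj≈A r s with s Fin.≟ j
    ... | yes ≡.refl = refl
    ... | no _ = refl
    Z-col : ∀ r → Z r j ≈ sum λ t → v t * B t r j
    Z-col r = begin
      Z r j                       ≈⟨ reflexive (Z-j r) ⟩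
      0#                          ≈⟨ Av≈0 r ⟨
      sum (λ t → A r t * v t)     ≈⟨ sum-cong-≋ (λ t → trans (*-comm _ _)
                                       (*-congˡ (reflexive (≡.sym (B-j t r))))) ⟩
      sum (λ t → v t * B t r j)   ∎
    Z-rest : ∀ t r s → s ≢ j → Z r s ≈ B t r s
    Z-rest t r s s≢j rewrite dec-false (s Fin.≟ j) s≢j = refl
    repeated : ∀ t → t ≢ j → v t * det (B t) ≈ 0#
    repeated t t≢j = trans (*-congˡ (det-equalColumns (B t) t≢j λ r →
      reflexive (≡.trans (B-off t r t t≢j) (≡.sym (B-j t r))))) (zeroʳ _)

  -- A triangular minor with diagonal -1 is thereby its own inverse.
  [-1]^n*[-1]^n≈1 : ∀ n → (- 1#) ^ n * (- 1#) ^ n ≈ 1#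
  [-1]^n*[-1]^n≈1 zero    = *-identityˡ 1#
  [-1]^n*[-1]^n≈1 (suc n) = begin
    ((- 1#) * σ) * ((- 1#) * σ)  ≈⟨ interchange _ _ _ _ ⟩
    ((- 1#) * (- 1#)) * (σ * σ)  ≈⟨ *-cong (trans (-1*x≈-x _) (-‿involutive 1#)) ([-1]^n*[-1]^n≈1 n) ⟩
    1# * 1#                      ≈⟨ *-identityˡ 1# ⟩
    1#                           ∎
    where σ = (- 1#) ^ n

-- Critical ideals

module Evaluation {X : Set} (ρ : X → ℤ) where
  open Polynomials X
  private
    module P = Matrices ℤ[X]
    module Z = Matrices ℤ.+-*-commutativeRing
  open import Algebra.Definitions.RawMonoid (CommutativeRing.+-rawMonoid ℤ[X])
    using () renaming (sum to sumᴾ)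
  open import Algebra.Definitions.RawMonoid (CommutativeRing.+-rawMonoid ℤ.+-*-commutativeRing)
    using () renaming (sum to sumᶻ)
  open import Algebra.Properties.Semiring.Exp (CommutativeRing.semiring ℤ[X])
    using () renaming (_^_ to _^ᴾ_)
  open import Algebra.Properties.Semiring.Exp (CommutativeRing.semiring ℤ.+-*-commutativeRing)
    using () renaming (_^_ to _^ᶻ_)
  open ≡ using (refl; sym; trans; cong; cong₂)

  eval : Poly → ℤ
  eval (var x)  = ρ x
  eval (con a)  = a
  eval (p :+ q) = eval p ℤ.+ eval q
  eval (p :* q) = eval p ℤ.* eval q
  eval (:- p)   = ℤ.- eval p

  eval-cong : ∀ {p q} → p ≈ q → eval p ≡ eval q
  eval-cong ≈-refl            = refl
  eval-cong (≈-sym e)         = sym (eval-cong e)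
  eval-cong (≈-trans e f)     = trans (eval-cong e) (eval-cong f)
  eval-cong (+-cong e f)      = cong₂ ℤ._+_ (eval-cong e) (eval-cong f)
  eval-cong (*-cong e f)      = cong₂ ℤ._*_ (eval-cong e) (eval-cong f)
  eval-cong (-‿cong e)        = cong ℤ.-_ (eval-cong e)
  eval-cong (con-+ a b)       = refl
  eval-cong (con-* a b)       = refl
  eval-cong (+-assoc p q r)   = ℤ.+-assoc (eval p) _ _
  eval-cong (+-comm p q)      = ℤ.+-comm (eval p) _
  eval-cong (+-identityˡ p)   = ℤ.+-identityˡ _
  eval-cong (-‿inverseˡ p)    = ℤ.+-inverseˡ (eval p)
  eval-cong (*-assoc p q r)   = ℤ.*-assoc (eval p) _ _
  eval-cong (*-comm p q)      = ℤ.*-comm (eval p) _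
  eval-cong (*-identityˡ p)   = ℤ.*-identityˡ _
  eval-cong (distribˡ p q r)  = ℤ.*-distribˡ-+ (eval p) _ _

  eval-sum : ∀ {n} (t : Fin n → Poly) → eval (sumᴾ t) ≡ sumᶻ (eval ∘ t)
  eval-sum {zero}  t = refl
  eval-sum {suc n} t = cong (λ x → eval (t zero) ℤ.+ x) (eval-sum (t ∘ suc))

  eval-^ : ∀ p n → eval (p ^ᴾ n) ≡ eval p ^ᶻ n
  eval-^ p zero    = refl
  eval-^ p (suc n) = cong (eval p ℤ.*_) (eval-^ p n)

  eval-det : ∀ {n} (A : P.Matrix n n) → eval (P.det A) ≡ Z.det λ r s → eval (A r s)
  eval-det {zero}  A = refl
  eval-det {suc n} A = trans
    (eval-sum λ j → (:- con (+ 1)) ^ᴾ toℕ j :* (A zero j :* P.det λ r s → A (suc r) (punchIn j s)))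
    (sum-cong-≗ λ j → cong₂ ℤ._*_ (eval-^ (:- con (+ 1)) (toℕ j))
      (cong (eval (A zero j) ℤ.*_) (eval-det λ r s → A (suc r) (punchIn j s))))
    where
    open import Algebra.Properties.Semiring.Sum
      (CommutativeRing.semiring ℤ.+-*-commutativeRing) using (sum-cong-≗)

  -- Evaluation is a ring homomorphism, so its kernel is an ideal and contains `S` only together
  -- with the ideal that `S` generates.
  eval-ideal : ∀ {s} {S : Poly → Set s} → (∀ {p} → S p → eval p ≡ + 0) →
    ∀ {p} → P.⟨ S ⟩ p → eval p ≡ + 0
  eval-ideal S0 (P.gen x)      = S0 x
  eval-ideal S0 P.null         = refl
  eval-ideal S0 (P.add x y)    = cong₂ ℤ._+_ (eval-ideal S0 x) (eval-ideal S0 y)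
  eval-ideal S0 (P.mul r x)    = trans (cong (eval r ℤ.*_) (eval-ideal S0 x)) (ℤ.*-zeroʳ (eval r))
  eval-ideal S0 (P.resp p≈q x) = trans (sym (eval-cong p≈q)) (eval-ideal S0 x)

-- Criteria for proper and for trivial critical ideals

module _ {n : ℕ} (G : Graph n) where
  open Polynomials (Fin n)
  open Matrices ℤ[X]
  open Evaluation {Fin n} using (eval; eval-cong; eval-det; eval-ideal)
  open import Algebra.Properties.Ring (CommutativeRing.ring ℤ[X]) using (+-inverseˡ-unique)
  private
    module Z = Matrices ℤ.+-*-commutativeRing

  -- If the minors vanish at an integer point, so does every element of the ideal, whereas the
  -- polynomial 1 takes the value 1 there.
  CriticalIdeal-proper : ∀ i (ρ : Fin n → ℤ) →
    (∀ (rows cols : Fin i → Fin n) → cols Preserves Fin._<_ ⟶ Fin._<_ →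
      Z.det (λ r s → eval ρ (laplacian G (rows r) (cols s))) ≡ + 0) →
    ¬ (CriticalIdeal G i ≐ UnitIdeal G)
  CriticalIdeal-proper i ρ vanish (_ , unit⊆) with
    eval-ideal ρ
      (λ { (rows , cols , _ , cols-mono , p≈det) →
           ≡.trans (eval-cong ρ p≈det)
             (≡.trans (eval-det ρ (λ r s → laplacian G (rows r) (cols s)))
               (vanish rows cols cols-mono)) })
      (unit⊆ (gen ≈-refl))
  ... | ()

  CriticalIdeal-unit : ∀ {i p} q → IsMinor i (laplacian G) p → q :* p ≈ con (+ 1) →
    CriticalIdeal G i ≐ UnitIdeal G
  CriticalIdeal-unit {p = p} q minor q*p≈1 =
    (λ {r} _ → resp (*-identityʳ r) (mul r (gen ≈-refl))) ,
    (λ {r} _ → resp (*-identityʳ r) (mul r (resp q*p≈1 (mul q (gen minor)))))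
    where open CommutativeRing ℤ[X] using (*-identityʳ)

  laplacian-diagonal : ∀ u → laplacian G u u ≡ var u
  laplacian-diagonal u rewrite dec-true (u Fin.≟ u) ≡.refl = ≡.refl

  laplacian-off : ∀ {u v} → u ≢ v → laplacian G u v ≡ con (ℤ.- (+ mult G u v))
  laplacian-off {u} {v} u≢v rewrite dec-false (u Fin.≟ v) u≢v = ≡.refl

  -- For `i ≤ j` the row index `rows i` lies strictly below `cols j`, so on and above the diagonal
  -- the minor meets no indeterminate and its entries are the constants given by the multiplicities.
  triangularMinor : ∀ {k} (rows cols : Fin k → Fin n) →
    rows Preserves Fin._<_ ⟶ Fin._<_ → cols Preserves Fin._<_ ⟶ Fin._<_ →
    (∀ i → rows i Fin.< cols i) →
    (∀ i → mult G (rows i) (cols i) ≡ 1) →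
    (∀ i j → i Fin.< j → mult G (rows i) (cols j) ≡ 0) →
    CriticalIdeal G k ≐ UnitIdeal G
  triangularMinor {k} rows cols rows-mono cols-mono below adjacent apart =
    CriticalIdeal-unit (det M) (rows , cols , rows-mono , cols-mono , ≈-refl)
      (≈-trans (*-cong det≈ det≈) ([-1]^n*[-1]^n≈1 k))
    where
    open Determinants ℤ[X]
    M : Matrix k k
    M r s = laplacian G (rows r) (cols s)
    above : ∀ i j → i Fin.< j → M i j ≈ con (+ 0)
    above i j i<j
      rewrite laplacian-off (Fin.<⇒≢ (ℕ.<-trans (below i) (cols-mono i<j))) | apart i j i<j = ≈-refl
    diag : ∀ i → M i i ≈ :- con (+ 1)
    diag i rewrite laplacian-off (Fin.<⇒≢ (below i)) | adjacent i =
      +-inverseˡ-unique _ _ (≈-sym (con-+ ℤ.-1ℤ (+ 1)))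
    det≈ = det-lowerTriangular M above diag

-- Strictly increasing maps between finite index sets

private
  shiftDown : ∀ {m n} (f : Fin m → Fin (suc n)) → f Preserves Fin._<_ ⟶ Fin._<_ →
    (∀ i → zero ≢ f i) →
    ∃ λ (g : Fin m → Fin n) → g Preserves Fin._<_ ⟶ Fin._<_ × (∀ i → f i ≡ suc (g i))
  shiftDown f mono 0≢f = g , g-mono , λ i → ≡.sym (eq i)
    where
    g : _
    g i = punchOut (0≢f i)
    eq : ∀ i → suc (g i) ≡ f i
    eq i = Fin.punchIn-punchOut (0≢f i)
    g-mono : g Preserves Fin._<_ ⟶ Fin._<_
    g-mono {i} {j} i<j = ℕ.≤-pred (≡.subst₂ Fin._<_ (≡.sym (eq i)) (≡.sym (eq j)) (mono i<j))

  0≢increasing : ∀ {m n} (f : Fin (suc m) → Fin (suc n)) → f Preserves Fin._<_ ⟶ Fin._<_ →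
    ∀ i → zero ≢ f (suc i)
  0≢increasing f mono i 0≡ with ≡.subst (f zero Fin.<_) (≡.sym 0≡) (mono (s≤s z≤n))
  ... | ()

  -- If `f` missed 0, it would shift down to an injection into a smaller set, against the pigeonhole
  -- principle. So 0 is fixed, and the induction continues with the tail shifted down.
  increasing⇒id : ∀ {n} (f : Fin n → Fin n) → f Preserves Fin._<_ ⟶ Fin._<_ → ∀ i → f i ≡ i
  increasing⇒id {suc n} f mono with zero Fin.≟ f zero
  ... | no 0≢f0 with shiftDown f mono (λ { zero → 0≢f0 ; (suc i) → 0≢increasing f mono i })
  ...   | g , g-mono , _ with Fin.pigeonhole (ℕ.n<1+n n) g
  ...     | i , j , i<j , gi≡gj = contradiction gi≡gj (Fin.<⇒≢ (g-mono i<j))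
  increasing⇒id {suc n} f mono | yes 0≡f0
    with shiftDown (f ∘ suc) (mono ∘ s≤s) (0≢increasing f mono)
  ...   | g , g-mono , eq = λ
    { zero    → ≡.sym 0≡f0
    ; (suc i) → ≡.trans (eq i) (≡.cong suc (increasing⇒id g g-mono i)) }

  -- `c` is the one value that `f` misses. Either it is 0, and the shifted map must be the identity,
  -- or 0 is attained first and `c` comes from the tail.
  increasing⇒punchIn : ∀ {n} (f : Fin n → Fin (suc n)) → f Preserves Fin._<_ ⟶ Fin._<_ →
    ∃ λ c → ∀ i → f i ≡ punchIn c i
  increasing⇒punchIn {zero} f mono = zero , λ ()
  increasing⇒punchIn {suc n} f mono with zero Fin.≟ f zero
  ... | no 0≢f0 with shiftDown f mono (λ { zero → 0≢f0 ; (suc i) → 0≢increasing f mono i })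
  ...   | g , g-mono , eq = zero , λ i → ≡.trans (eq i) (≡.cong suc (increasing⇒id g g-mono i))
  increasing⇒punchIn {suc n} f mono | yes 0≡f0
    with shiftDown (f ∘ suc) (mono ∘ s≤s) (0≢increasing f mono)
  ...   | g , g-mono , eq with increasing⇒punchIn g g-mono
  ...     | c , eq′ = suc c , λ
    { zero    → ≡.sym 0≡f0
    ; (suc i) → ≡.trans (eq i) (≡.cong suc (eq′ i)) }

-- The integer Laplacian and its kernel

module _ {m : ℕ} (G : Graph (suc m)) where
  open Evaluation {Fin (suc m)} using (eval)
  open Determinants ℤ.+-*-commutativeRing using (det-kernel)
  open import Algebra.Properties.Semiring.Sum (CommutativeRing.semiring ℤ.+-*-commutativeRing)
  open ≡.≡-Reasoning

  -- The value substituted for the indeterminate of `u`. Summing over the vertices other than `u`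
  -- makes each row of `L` sum to zero even if `G` has loops.
  degree : Fin (suc m) → ℤ
  degree u = sum λ w → + mult G u (punchIn u w)

  private
    L : Fin (suc m) → Fin (suc m) → ℤ
    L u v = eval degree (laplacian G u v)

    L-off : ∀ {u v} → u ≢ v → L u v ≡ ℤ.- (+ mult G u v)
    L-off u≢v = ≡.cong (eval degree) (laplacian-off G u≢v)

    L-rowSum : ∀ u → sum (L u) ≡ + 0
    L-rowSum u = begin
      sum (L u)                                    ≡⟨ sum-remove {i = u} (L u) ⟩
      L u u ℤ.+ sum (λ w → L u (punchIn u w))      ≡⟨ ≡.cong₂ ℤ._+_
        (≡.cong (eval degree) (laplacian-diagonal G u))
        (sum-cong-≗ λ w → L-off (Fin.punchInᵢ≢i u w ∘ ≡.sym)) ⟩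
      degree u ℤ.+ sum (λ w → ℤ.- d w)             ≡⟨ ∑-distrib-+ d (λ w → ℤ.- d w) ⟨
      sum (λ w → d w ℤ.+ ℤ.- d w)                  ≡⟨ sum-cong-≗ (λ w → ℤ.+-inverseʳ (d w)) ⟩
      sum {m} (λ _ → + 0)                          ≡⟨ sum-replicate-zero m ⟩
      + 0                                          ∎
      where
      d : Fin m → ℤ
      d w = + mult G u (punchIn u w)

    -- In row `u` the value `h w` may be replaced by `h u`: they agree on neighbours, and the other
    -- off-diagonal entries are zero. What remains is `h u` times the row sum.
    L-kernel : (h : Fin (suc m) → ℤ) → (∀ u w → mult G u w ≢ 0 → h u ≡ h w) →
      ∀ u → sum (λ w → L u w ℤ.* h w) ≡ + 0
    L-kernel h const u = begin
      sum (λ w → L u w ℤ.* h w)  ≡⟨ sum-cong-≗ entry ⟩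
      sum (λ w → L u w ℤ.* h u)  ≡⟨ *-distribʳ-sum (h u) (L u) ⟨
      sum (L u) ℤ.* h u          ≡⟨ ≡.cong (ℤ._* h u) (L-rowSum u) ⟩
      + 0 ℤ.* h u                ≡⟨ ℤ.*-zeroˡ (h u) ⟩
      + 0                        ∎
      where
      entry : ∀ w → L u w ℤ.* h w ≡ L u w ℤ.* h u
      entry w with u Fin.≟ w
      ... | yes ≡.refl = ≡.refl
      ... | no u≢w with mult G u w ℕ.≟ 0
      ...   | yes ≡0 rewrite ≡0 = ≡.refl
      ...   | no ≢0 rewrite const u w ≢0 = ≡.refl

  -- An increasing choice of all the columns is the identity, so each row of the minor is a whole
  -- row of `L` and annihilates the all-ones vector.
  CriticalIdeal-full-proper : ¬ (CriticalIdeal G (suc m) ≐ UnitIdeal G)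
  CriticalIdeal-full-proper = CriticalIdeal-proper G (suc m) degree λ rows cols cols-mono →
    det-kernel (λ r s → L (rows r) (cols s)) (λ _ → + 1)
      (λ r → ≡.trans
        (sum-cong-≗ λ s → ≡.cong (λ c → L (rows r) c ℤ.* + 1) (increasing⇒id cols cols-mono s))
        (L-kernel (λ _ → + 1) (λ _ _ _ → ≡.refl) (rows r)))
      zero ≡.refl

  -- The columns of an m × m minor omit a single vertex c, so the indicator of
  -- a class not containing c restricts to a kernel vector.
  CriticalIdeal-disconnected-proper : (class : Fin (suc m) → Bool) →
    (∀ u w → mult G u w ≢ 0 → class u ≡ class w) →
    (∀ c → ∃ λ u → class u ≢ class c) →
    ¬ (CriticalIdeal G m ≐ UnitIdeal G)
  CriticalIdeal-disconnected-proper class closed other =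
    CriticalIdeal-proper G m degree vanish
    where
    vanish : ∀ (rows cols : Fin m → Fin (suc m)) → cols Preserves Fin._<_ ⟶ Fin._<_ → _
    vanish rows cols cols-mono with increasing⇒punchIn cols cols-mono
    ... | c , cols≡ = det-kernel (λ r s → L (rows r) (cols s)) (h ∘ cols) kernel
      -- The position of `u` among the columns, where the kernel vector takes the value 1 that
      -- `det-kernel` asks for.
      (punchOut c≢u) (≡.trans (≡.cong h (≡.trans (cols≡ _) (Fin.punchIn-punchOut c≢u))) h-u)
      where
      h : Fin (suc m) → ℤ
      h w = if does (class w Bool.≟ class c) then + 0 else + 1
      u = proj₁ (other c)
      c≢u : c ≢ u
      c≢u c≡u = proj₂ (other c) (≡.cong class (≡.sym c≡u))
      h-u : h u ≡ + 1
      h-u rewrite dec-false (class u Bool.≟ class c) (proj₂ (other c)) = ≡.refl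
      h-c : h c ≡ + 0
      h-c rewrite dec-true (class c Bool.≟ class c) ≡.refl = ≡.refl
      kernel : ∀ r → sum (λ s → L (rows r) (cols s) ℤ.* h (cols s)) ≡ + 0
      -- Since `h c` is 0, putting the omitted column `c` back does not change the sum.
      kernel r = begin
        sum (λ s → t (cols s))              ≡⟨ sum-cong-≗ (λ s → ≡.cong t (cols≡ s)) ⟩
        sum (λ s → t (punchIn c s))         ≡⟨ ℤ.+-identityˡ _ ⟨
        + 0 ℤ.+ sum (λ s → t (punchIn c s)) ≡⟨ ≡.cong (ℤ._+ sum (λ s → t (punchIn c s)))
          (≡.trans (≡.cong (L (rows r) c ℤ.*_) h-c) (ℤ.*-zeroʳ (L (rows r) c))) ⟨
        t c ℤ.+ sum (λ s → t (punchIn c s)) ≡⟨ sum-remove {i = c} t ⟨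
        sum t                               ≡⟨ L-kernel h (λ w w′ adj → ≡.cong
          (λ b → if does (b Bool.≟ class c) then + 0 else + 1) (closed w w′ adj)) (rows r) ⟩
        + 0                                 ∎
        where
        t : Fin (suc m) → ℤ
        t w = L (rows r) w ℤ.* h w

-- From critical ideals to the co-rank

CriticalIdeal-last-proper : ∀ {m} (G : Graph (suc m)) (i : Fin (suc m)) → m ≤ toℕ i →
  ¬ (CriticalIdeal G (suc (toℕ i)) ≐ UnitIdeal G)
CriticalIdeal-last-proper G i m≤i =
  ≡.subst (λ j → ¬ (CriticalIdeal G (suc j) ≐ UnitIdeal G))
    (ℕ.≤-antisym m≤i (Fin.toℕ≤pred[n] i)) (CriticalIdeal-full-proper G)

initialSegment : ∀ {n k} → k ≤ n →
  ∃ λ (T : Subset n) → (∀ i → i ∈ T ⇔ toℕ i < k) × ∣ T ∣ ≡ k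
initialSegment {n} {zero} _ =
  ⊥ , (λ i → mk⇔ (λ i∈⊥ → contradiction i∈⊥ Subset.∉⊥) (λ ())) , Subset.∣⊥∣≡0 n
initialSegment {suc n} {suc k} (s≤s k≤n) with initialSegment k≤n
... | T , T⇔ , ∣T∣≡k = inside ∷ T , mem , ≡.cong suc ∣T∣≡k
  where
  mem : ∀ i → i ∈ inside ∷ T ⇔ toℕ i < suc k
  mem zero    = mk⇔ (λ _ → s≤s z≤n) (λ _ → here)
  mem (suc i) = mk⇔ (λ { (there i∈T) → s≤s (Equivalence.to (T⇔ i) i∈T) })
    (λ { (s≤s i<k) → there (Equivalence.from (T⇔ i) i<k) })

-- The trivial indices form an initial segment. The element `i` of `Fin n` stands for the ideal of
-- index `suc (toℕ i)`, so `k ≤ toℕ i` describes the indices above `k`.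
CoRank-threshold : ∀ {n} (G : Graph n) {k} → k ≤ n →
  (∀ i → i ≤ k → CriticalIdeal G i ≐ UnitIdeal G) →
  (∀ i → k ≤ toℕ i → ¬ (CriticalIdeal G (suc (toℕ i)) ≐ UnitIdeal G)) →
  CoRank G k
CoRank-threshold G {k} k≤n trivial proper with initialSegment k≤n
... | T , T⇔ , ∣T∣≡k = T , mem , ∣T∣≡k
  where
  mem : ∀ i → i ∈ T ⇔ (CriticalIdeal G (suc (toℕ i)) ≐ UnitIdeal G)
  mem i = mk⇔ (λ i∈T → trivial (suc (toℕ i)) (Equivalence.to (T⇔ i) i∈T))
    (λ I≐1 → Equivalence.from (T⇔ i) (ℕ.≰⇒> λ k≤i → proper i k≤i I≐1))

-- A co-rank of `m + 1` would put every index into `T`, among them the last, whose ideal is proper.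
CoRank-≤ : ∀ {m} (G : Graph (suc m)) {a} → CoRank G a → a ≤ m
CoRank-≤ {m} G (T , T⇔ , ≡.refl) = ℕ.≤-pred (ℕ.≤∧≢⇒< (Subset.∣p∣≤n T) λ ∣T∣≡n →
  CriticalIdeal-last-proper G (fromℕ m) (ℕ.≤-reflexive (≡.sym (Fin.toℕ-fromℕ m)))
    (Equivalence.to (T⇔ (fromℕ m))
      (≡.subst (fromℕ m ∈_) (≡.sym (Subset.∣p∣≡n⇒p≡⊤ ∣T∣≡n)) Subset.∈⊤)))

-- `f` lists edges between consecutive vertices, `inject₁ x` being the vertex `x` and `suc x` the
-- vertex `x + 1`. Keeping the first `i` of them gives a triangular minor for each `i ≤ k`.
CriticalIdeal-chain : ∀ {n k} (G : Graph (suc n)) (f : Fin k → Fin n) →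
  f Preserves Fin._<_ ⟶ Fin._<_ →
  (∀ i → mult G (inject₁ (f i)) (suc (f i)) ≡ 1) →
  (∀ x y → x Fin.< y → mult G (inject₁ x) (suc y) ≡ 0) →
  ∀ i → i ≤ k → CriticalIdeal G i ≐ UnitIdeal G
CriticalIdeal-chain G f f-mono adjacent apart i i≤k =
  triangularMinor G (inject₁ ∘ g) (suc ∘ g)
    (λ x<y → inject₁-mono-< (g-mono x<y))
    (s≤s ∘ g-mono)
    (λ x → s≤s (ℕ.≤-reflexive (Fin.toℕ-inject₁ (g x))))
    (λ x → adjacent (inject≤ x i≤k))
    (λ x y x<y → apart (g x) (g y) (g-mono x<y))
  where
  g : Fin i → Fin _
  g x = f (inject≤ x i≤k)
  g-mono : g Preserves Fin._<_ ⟶ Fin._<_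
  g-mono {x} {y} x<y = f-mono (≡.subst₂ _<_
    (≡.sym (Fin.toℕ-inject≤ x i≤k)) (≡.sym (Fin.toℕ-inject≤ y i≤k)) x<y)

-- Paths

∣n-1+n∣≡1 : ∀ n → ∣ n - suc n ∣ ≡ 1
∣n-1+n∣≡1 zero    = ≡.refl
∣n-1+n∣≡1 (suc n) = ∣n-1+n∣≡1 n

∣m-n∣≢1 : ∀ {m n} → suc m < n → ∣ m - n ∣ ≢ 1
∣m-n∣≢1 {zero}  (s≤s (s≤s _)) ()
∣m-n∣≢1 {suc m} (s≤s m<n) = ∣m-n∣≢1 m<n

path-adjacent : ∀ {n} {u v : Fin n} → toℕ v ≡ suc (toℕ u) → mult (path n) u v ≡ 1
path-adjacent {u = u} eq rewrite eq | ∣n-1+n∣≡1 (toℕ u) = ≡.refl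

path-apart : ∀ {n} {u v : Fin n} → suc (toℕ u) < toℕ v → mult (path n) u v ≡ 0
path-apart {u = u} {v} lt rewrite dec-false (∣ toℕ u - toℕ v ∣ ℕ.≟ 1) (∣m-n∣≢1 lt) = ≡.refl

path-simple : ∀ n → Simple (path n)
path-simple n = record { loopless = loopless ; no-parallel = no-parallel }
  where
  loopless : ∀ v → mult (path n) v v ≡ 0
  loopless v rewrite ℕ.∣n-n∣≡0 (toℕ v) = ≡.refl
  no-parallel : ∀ u v → mult (path n) u v ≤ 1
  no-parallel u v with ∣ toℕ u - toℕ v ∣ ℕ.≟ 1
  ... | yes eq rewrite eq = ℕ.≤-refl
  ... | no ne rewrite dec-false (∣ toℕ u - toℕ v ∣ ℕ.≟ 1) ne = z≤n

-- Multiplicities in a path depend on differences only, and `suc` on both ends cancels by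
-- computation; hence `gmap suc id` shifts a walk by one vertex.
path-connected : ∀ n → Connected (path n)
path-connected (suc n)       zero    zero    = ε
path-connected (suc (suc n)) zero    (suc v) = (λ ()) ◅ gmap suc id (path-connected (suc n) zero v)
path-connected (suc (suc n)) (suc u) zero    =
  gmap suc id (path-connected (suc n) u zero) ◅◅ ((λ ()) ◅ ε)
path-connected (suc n)       (suc u) (suc v) = gmap suc id (path-connected n u v)

path-CoRank : ∀ n → CoRank (path (suc n)) n
path-CoRank n = CoRank-threshold (path (suc n)) (ℕ.n≤1+n n)
  (CriticalIdeal-chain (path (suc n)) id id
    (λ x → path-adjacent (≡.cong suc (≡.sym (Fin.toℕ-inject₁ x))))
    (λ x y x<y → path-apart (s≤s (≡.subst (_< toℕ y) (≡.sym (Fin.toℕ-inject₁ x)) x<y))))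
  (CriticalIdeal-last-proper (path (suc n)))

-- Paths with a vertex deleted

private
  punchIn-mono-< : ∀ {n} (v : Fin (suc n)) {x y : Fin n} → x Fin.< y → punchIn v x Fin.< punchIn v y
  punchIn-mono-< v {x} {y} x<y = ℕ.≤∧≢⇒< (Fin.punchIn-mono-≤ v x y (ℕ.<⇒≤ x<y))
    λ eq → Fin.<⇒≢ x<y (Fin.punchIn-injective v x y (Fin.toℕ-injective eq))

  ≤-punchIn : ∀ {n} (v : Fin (suc n)) (x : Fin n) → x Fin.≤ punchIn v x
  ≤-punchIn zero    x       = ℕ.n≤1+n (toℕ x)
  ≤-punchIn (suc v) zero    = z≤n
  ≤-punchIn (suc v) (suc x) = s≤s (≤-punchIn v x)

  -- Among the remaining vertices, those at positions `x` and `x + 1` are separated only by the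
  -- deletion of the vertex `x + 1`.
  punchIn-consecutive : ∀ {n} (v : Fin (2 + n)) (x : Fin n) → suc (toℕ x) ≢ toℕ v →
    toℕ (punchIn v (suc x)) ≡ suc (toℕ (punchIn v (inject₁ x)))
  punchIn-consecutive zero          x       _  = ≡.cong (λ y → 2 + y) (≡.sym (Fin.toℕ-inject₁ x))
  punchIn-consecutive (suc zero)    zero    ne = contradiction ≡.refl ne
  punchIn-consecutive (suc (suc v)) zero    _  = ≡.refl
  punchIn-consecutive (suc v)       (suc x) ne =
    ≡.cong suc (punchIn-consecutive v x (ne ∘ ≡.cong suc))

module _ {n : ℕ} (v : Fin (2 + n)) where
  private
    G = path (2 + n) ∖ v

  deleted-chain : ∀ {k} (f : Fin k → Fin n) → f Preserves Fin._<_ ⟶ Fin._<_ →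
    (∀ i → suc (toℕ (f i)) ≢ toℕ v) → ∀ i → i ≤ k → CriticalIdeal G i ≐ UnitIdeal G
  deleted-chain f f-mono avoid = CriticalIdeal-chain G f f-mono
    (λ i → path-adjacent (punchIn-consecutive v (f i) (avoid i)))
    -- The two strict steps from `inject₁ x` to `inject₁ y` to `suc y` survive `punchIn v`, so the
    -- gap stays at least 2.
    λ x y x<y → path-apart (ℕ.≤-trans
      (s≤s (punchIn-mono-< v {inject₁ x} {inject₁ y} (inject₁-mono-< x<y)))
      (punchIn-mono-< v {inject₁ y} {suc y} (s≤s (ℕ.≤-reflexive (Fin.toℕ-inject₁ y)))))

  -- The hypothesis excludes `v = 1, …, n`, so `v` is an end of the path and all `n` consecutive
  -- pairs remain edges.
  endpoint-CoRank : (∀ (x : Fin n) → suc (toℕ x) ≢ toℕ v) → CoRank G n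
  endpoint-CoRank avoid = CoRank-threshold G (ℕ.n≤1+n n) (deleted-chain id id avoid)
    (CriticalIdeal-last-proper G)

-- Of the `n + 1` consecutive pairs among the `n + 2` remaining vertices only the pair at position
-- `w` is broken, so `punchIn w` lists `n` edges. The two sides of `v` are then disconnected, which
-- makes the ideal of index `n + 1` proper.
interior-CoRank : ∀ {n} (w : Fin (suc n)) → CoRank (path (3 + n) ∖ suc (inject₁ w)) n
interior-CoRank {n} w = CoRank-threshold G (ℕ.m≤n⇒m≤1+n (ℕ.n≤1+n n))
  (deleted-chain v (punchIn w) (punchIn-mono-< w)
    λ i eq → Fin.punchInᵢ≢i w i (Fin.toℕ-injective
      (≡.trans (ℕ.suc-injective eq) (Fin.toℕ-inject₁ w))))
  proper
  where
  v : Fin (3 + n)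
  v = suc (inject₁ w)
  G = path (3 + n) ∖ v

  class : Fin (2 + n) → Bool
  class u = does (toℕ (punchIn v u) ℕ.<? toℕ v)

  v<punchIn : ∀ u → ¬ (toℕ (punchIn v u) < toℕ v) → toℕ v < toℕ (punchIn v u)
  v<punchIn u ≮ = ℕ.≤∧≢⇒< (ℕ.≮⇒≥ ≮) (Fin.punchInᵢ≢i v u ∘ Fin.toℕ-injective ∘ ≡.sym)

  across : ∀ u w → toℕ (punchIn v u) < toℕ v → ¬ (toℕ (punchIn v w) < toℕ v) → mult G u w ≡ 0
  across u w u< w≮ = path-apart (ℕ.≤-trans (s≤s u<) (v<punchIn w w≮))

  closed : ∀ u w → mult G u w ≢ 0 → class u ≡ class w
  closed u w adj with toℕ (punchIn v u) ℕ.<? toℕ v | toℕ (punchIn v w) ℕ.<? toℕ v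
  ... | yes u< | yes w< = ≡.trans (dec-true (_ ℕ.<? _) u<) (≡.sym (dec-true (_ ℕ.<? _) w<))
  ... | yes u< | no w≮  = contradiction (across u w u< w≮) adj
  ... | no u≮  | yes w< = contradiction (≡.trans (mult-sym G u w) (across w u w< u≮)) adj
  ... | no u≮  | no w≮  = ≡.trans (dec-false (_ ℕ.<? _) u≮) (≡.sym (dec-false (_ ℕ.<? _) w≮))

  last : Fin (2 + n)
  last = fromℕ (suc n)
  v≤last : toℕ v ≤ toℕ last
  v≤last = ≡.subst₂ _≤_ (≡.cong suc (≡.sym (Fin.toℕ-inject₁ w))) (≡.sym (Fin.toℕ-fromℕ (suc n)))
    (Fin.toℕ<n w)

  other : ∀ c → ∃ λ u → class u ≢ class c
  other c with class c
  -- The vertex 0 lies before `v`, a successor, so `class zero` computes to `true`.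
  ... | false = zero , λ ()
  ... | true  = last , λ eq →
    contradiction (≡.trans (≡.sym eq) (dec-false (_ ℕ.<? _) last≮)) λ ()
    where
    last≮ : ¬ (toℕ (punchIn v last) < toℕ v)
    last≮ = ℕ.≤⇒≯ (ℕ.≤-trans v≤last (≤-punchIn v last))

  proper : ∀ i → n ≤ toℕ i → ¬ (CriticalIdeal G (suc (toℕ i)) ≐ UnitIdeal G)
  -- Two indices are left: `n + 2`, the full determinant, and `n + 1`, where disconnectedness
  -- enters.
  proper i n≤i with ℕ.m≤n⇒m<n∨m≡n n≤i
  ... | inj₁ n<i = CriticalIdeal-last-proper G i n<i
  ... | inj₂ n≡i = ≡.subst (λ j → ¬ (CriticalIdeal G (suc j) ≐ UnitIdeal G))
    n≡i (CriticalIdeal-disconnected-proper G class closed other)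

-- Deleting an end lowers the co-rank by 1, deleting an interior vertex by 2.
path-deleted-γ< : ∀ n (v : Fin (2 + n)) → path (2 + n) ∖ v γ< path (2 + n)
path-deleted-γ< n zero = n , suc n , endpoint-CoRank zero (λ _ ()) , path-CoRank (suc n) , ℕ.n<1+n n
path-deleted-γ< n (suc v) with view v
... | ‵fromℕ = n , suc n ,
  endpoint-CoRank (suc (fromℕ n))
    (λ x eq → ℕ.<⇒≢ (Fin.toℕ<n x) (≡.trans (ℕ.suc-injective eq) (Fin.toℕ-fromℕ n))) ,
  path-CoRank (suc n) , ℕ.n<1+n n
-- An interior vertex requires at least three vertices, so the parameter is a successor here.
path-deleted-γ< (suc n) (suc _) | ‵inject₁ w =
  n , 2 + n , interior-CoRank w , path-CoRank (2 + n) , ℕ.m≤n⇒m≤1+n (ℕ.n<1+n n)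

theorem5p1 : ∀ (n : ℕ) →
    Forb n (path (2 + n))
    × CoRank (path (2 + n)) (1 + n)
    × (∀ (v : Fin (2 + n)) → path (2 + n) ∖ v γ< path (2 + n))
theorem5p1 n =
  ( (path-simple (2 + n) , path-connected (2 + n) , 1 + n , path-CoRank (1 + n) , ℕ.≤-refl)
  , minimal )
  , path-CoRank (1 + n)
  , path-deleted-γ< n
  where
  minimal : ∀ {m} (H : Graph m) → InducedSubgraph H (path (2 + n)) → m < 2 + n → ¬ Forbidden n H
  minimal {zero}  H _ _ (_ , _ , a , (T , _ , ≡.refl) , n<a) =
    contradiction (ℕ.≤-trans n<a (Subset.∣p∣≤n T)) λ ()
  -- The co-rank bound gives `a ≤ m ≤ n`, against `n < a`.
  minimal {suc m} H _ m<2+n (_ , _ , a , γ≡a , n<a) =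
    ℕ.<⇒≱ n<a (ℕ.≤-trans (CoRank-≤ H γ≡a) (ℕ.≤-pred (ℕ.≤-pred m<2+n)))
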